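{- There exist absolute constants $C>0$ and $\Delta_0$ such that for every finite graph $G$ that is a line graph (i.e. $G$ is the line graph of some finite graph $H$) and has maximum degree $\Delta\ge\Delta_0$, the conflict-free chromatic number of $G$ satisfies $\chi_{CF}(G)\le C\ln\Delta$. (That is, $\chi_{CF}(G)=O(\ln\Delta)$ for line graphs $G$ of maximum degree $\Delta$.)
   Context: All graphs are finite and simple. For a vertex $v$ of $G$, the closed neighborhood $N[v]$ consists of $v$ and all its neighbors. A (not necessarily proper) coloring of the vertices of $G$ is conflict-free if for every vertex $v\in V(G)$ there is a color that appears on exactly one vertex of $N[v]$. The conflict-free chromatic number $\chi_{CF}(G)$ is the minimum number of colors in a conflict-free coloring of the vertices of $G$ (every vertex is colored). The line graph of a graph $H$ has vertex set $E(H)$, with two distinct edges of $H$ adjacent iff they share an endpoint. -}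

module Defs where

open import Data.Bool.Base using (Bool; false; T)
open import Data.Fin.Base using (Fin; _<_; finToFun; funToFin)
open import Data.Fin.Properties using (_≟_; any?; all?; finToFun-funToFin)
open import Data.Fin.Subset using (Subset; _∈_; _∪_; ⁅_⁆; ∣_∣)
open import Data.Fin.Subset.Properties using (_∈?_; x∈⁅x⁆; q⊆p∪q)
open import Data.List.Base as List using ()
open import Data.List.Extrema.Nat using (max)
open import Data.Nat.Base using (ℕ; zero; suc; _+_; _*_; _^_; _!; _≤_; z≤n; s≤s)
open import Data.Product using (Σ-syntax; ∃; ∃-syntax; ∃!; _×_; _,_; proj₁; proj₂)
open import Data.Sum.Base using (_⊎_)
open import Data.Vec.Base as Vec using ()
open import Function.Base using (_∘_; id)
open import Function.Bundles using (_↔_; _⇔_; module Inverse)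
open import Relation.Binary.PropositionalEquality using (_≡_; _≢_; _≗_; refl; sym; trans)
open import Relation.Nullary.Decidable using (Dec; yes; no; map′; _×-dec_; _→-dec_)
open import Relation.Nullary.Negation using (contradiction)
open import Relation.Unary using (Decidable)

record Graph : Set where
  field
    order  : ℕ
    adj    : Fin order → Fin order → Bool
    adj-sym    : ∀ u v → adj u v ≡ adj v u
    adj-irrefl : ∀ v → adj v v ≡ false

  Vertex : Set
  Vertex = Fin order

  Adj : Vertex → Vertex → Set
  Adj u v = T (adj u v)

  N⟨_⟩ : Vertex → Subset order
  N⟨ v ⟩ = Vec.tabulate (adj v)

  N[_] : Vertex → Subset order
  N[ v ] = N⟨ v ⟩ ∪ ⁅ v ⁆

  degree : Vertex → ℕ
  degree v = ∣ N⟨ v ⟩ ∣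

  -- The graph without vertices gets maximum degree 0.
  maxDegree : ℕ
  maxDegree = max 0 (List.tabulate degree)

open Graph public using (Vertex; Adj; N[_]; degree; maxDegree)

-- An unordered edge is represented by its endpoints in increasing order. All
-- proofs of Adj and of _<_ are equal, so each edge has exactly one element.
record Edge (H : Graph) : Set where
  field
    src tgt : Vertex H
    src<tgt : src < tgt
    joined  : Adj H src tgt

_∈ᵉ_ : ∀ {H} → Vertex H → Edge H → Set
v ∈ᵉ e = v ≡ Edge.src e ⊎ v ≡ Edge.tgt e

ShareEndpoint : ∀ {H} → Edge H → Edge H → Set
ShareEndpoint {H} e f = Σ[ v ∈ Vertex H ] (v ∈ᵉ e × v ∈ᵉ f)

-- G is, up to isomorphism, the line graph of H.
IsLineGraphOf : Graph → Graph → Set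
IsLineGraphOf G H =
  Σ[ φ ∈ Vertex G ↔ Edge H ]
    (∀ x y → Adj G x y ⇔
      (Inverse.to φ x ≢ Inverse.to φ y × ShareEndpoint (Inverse.to φ x) (Inverse.to φ y)))

IsLineGraph : Graph → Set
IsLineGraph G = ∃[ H ] IsLineGraphOf G H

Coloring : Graph → ℕ → Set
Coloring G k = Vertex G → Fin k

ConflictFree : (G : Graph) {k : ℕ} → Coloring G k → Set
ConflictFree G c = ∀ v → ∃[ a ] ∃! _≡_ (λ u → u ∈ N[_] G v × c u ≡ a)

ConflictFreeColorable : Graph → ℕ → Set
ConflictFreeColorable G k = Σ[ c ∈ Coloring G k ] ConflictFree G c

IsLeast : (ℕ → Set) → ℕ → Set
IsLeast P k = P k × (∀ j → P j → k ≤ j)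

least : {P : ℕ → Set} → Decidable P → ∀ n → P n → ∃ (IsLeast P)
least P? n p with P? 0
... | yes p₀ = 0 , p₀ , λ _ _ → z≤n
least P? zero    p | no ¬p₀ = contradiction p ¬p₀
least {P} P? (suc n) p | no ¬p₀ with least {P ∘ suc} (P? ∘ suc) n p
... | k , pk , k-least = suc k , pk , λ where
  zero    p₀ → contradiction p₀ ¬p₀
  (suc j) pj → s≤s (k-least j pj)

module _ (G : Graph) where

  conflictFree? : ∀ {k} (c : Coloring G k) → Dec (ConflictFree G c)
  conflictFree? c = all? λ v → any? λ a → any? λ u →
    (u ∈? N[_] G v ×-dec c u ≟ a) ×-dec
    map′ (λ h {y} → h y) (λ h y → h {y})
      (all? λ y → (y ∈? N[_] G v ×-dec c y ≟ a) →-dec (u ≟ y))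

  conflictFree-resp-≗ : ∀ {k} {c d : Coloring G k} → c ≗ d → ConflictFree G c → ConflictFree G d
  conflictFree-resp-≗ c≗d cf v with cf v
  ... | a , u , (u∈ , cu≡a) , unique =
    a , u , (u∈ , trans (sym (c≗d u)) cu≡a) ,
    λ (y∈ , dy≡a) → unique (y∈ , trans (c≗d _) dy≡a)

  conflictFreeColorable? : Decidable (ConflictFreeColorable G)
  conflictFreeColorable? k = map′
    (λ (i , cf) → finToFun i , cf)
    (λ (c , cf) → funToFin c , conflictFree-resp-≗ (sym ∘ finToFun-funToFin c) cf)
    (any? λ i → conflictFree? (finToFun {k} {Graph.order G} i))

  conflictFreeColorable-order : ConflictFreeColorable G (Graph.order G)
  conflictFreeColorable-order =
    id , λ v → v , v , (q⊆p∪q _ _ (x∈⁅x⁆ v) , refl) , λ (_ , y≡v) → sym y≡v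

  χCF-least : ∃ (IsLeast (ConflictFreeColorable G))
  χCF-least = least conflictFreeColorable? (Graph.order G) conflictFreeColorable-order

  χCF : ℕ
  χCF = proj₁ χCF-least

  χCF-isLeast : IsLeast (ConflictFreeColorable G) χCF
  χCF-isLeast = proj₂ χCF-least

-- expNum n / n ! = Σ_{i ≤ n} 1 / i !, the partial sums of the series for e.
expNum : ℕ → ℕ
expNum zero    = 1
expNum (suc n) = suc n * expNum n + 1

-- The real inequality m ≤ C · ln N, i.e. e ^ m ≤ N ^ C. Since the partial sums
-- of Σ 1 / i ! increase to e, this says (expNum n / n !) ^ m ≤ N ^ C for all n.
-- It is false at N = 0 when C > 0, in line with ln 0 = -∞.
infix 4 _≤_·ln_
_≤_·ln_ : ℕ → ℕ → ℕ → Set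
m ≤ C ·ln N = ∀ n → expNum n ^ m ≤ N ^ C * (n !) ^ m

{-# OPTIONS --safe #-}

-- Let G be the line graph of H. Every vertex of H has degree at most Δ + 1, so H
-- has a proper colouring with 2 ^ L colours as soon as Δ + 2 ≤ 2 ^ L. Assign to
-- each edge of H a level, a bit in which the colours of its ends differ: the edges
-- of one level form a bipartite graph with sides X (bit 0) and Y (bit 1). Let
-- S ⊆ Y be a minimal set dominating the non-isolated vertices of X. Each s ∈ S has
-- a private edge, whose end in X has no other neighbour in S. Give one private
-- edge of each s ∈ S colour 1, give one edge to S from each remaining vertex of X
-- colour 0, and leave the other edges blank. An edge with an end s ∈ S sees
-- colour 1 only on the chosen private edge of s; any other edge xy sees exactly
-- one non-blank edge, the one at x. Using two new colours on every level and one
-- further colour for all the blank edges gives 2 L + 1 colours.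
module Submission where

open import Defs
open import Data.Bool.Base using (T)
open import Data.Bool.Properties using (T-irrelevant; T-≡; T?)
open import Data.Fin.Base using (Fin; zero; suc; toℕ; fromℕ<; combine; finToFun; funToFin)
open import Data.Fin.Properties as Fin using (_≟_; any?; all?; ¬∀⟶∃¬; combine-injective; toℕ-injective; toℕ-fromℕ<; toℕ<n; funToFin-finToFin; suc-injective; 0≢1+n)
open import Data.Fin.Subset using (Subset; _∈_; _-_; ⊤; ∣_∣)
open import Data.Fin.Subset.Properties using (_∈?_; ∈⊤; x∈p∧x≢y⇒x∈p-y; x∈p⇒∣p-x∣<∣p∣; x∈p∪q⁺; x∈p∪q⁻; x∈⁅x⁆; x∈⁅y⁆⇒x≡y)
open import Data.List.Base as List using ()
open import Data.List.Extrema.Nat using (xs≤max)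
open import Data.List.Relation.Unary.All.Properties using (tabulate⁻)
open import Data.Maybe.Base using (Maybe; just; nothing; maybe′)
open import Data.Nat.Base using (ℕ; zero; suc; _+_; _*_; _^_; _!; _≤_; _<_; z≤n; s≤s)
open import Data.Nat.Induction using (<-wellFounded)
open import Data.Nat.Properties as ℕ using ()
open import Data.Nat.Solver using (module +-*-Solver)
open import Data.Product using (∃; ∃-syntax; ∃!; _×_; _,_; proj₁; proj₂)
open import Data.Sum.Base using (_⊎_; inj₁; inj₂; [_,_]′)
open import Data.Vec.Properties using (lookup∘tabulate; lookup⇒[]=; []=⇒lookup)
open import Function.Base using (_∘_; case_of_)
open import Function.Bundles using (module Inverse; module Equivalence)
open import Induction.WellFounded using (Acc; acc)
open import Relation.Binary.Definitions using (tri<; tri≈; tri>)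
open import Relation.Binary.PropositionalEquality using (_≡_; _≢_; _≗_; refl; sym; trans; cong; cong₂; subst; ≢-sym)
open import Relation.Nullary.Decidable using (yes; no; ¬?; _×-dec_; _→-dec_; decidable-stable)
open import Relation.Nullary.Negation using (¬_; contradiction)
open import Relation.Unary using (Decidable)

open +-*-Solver using (solve; _:+_; _:*_; _:^_; _:=_; con)

-- Finite sets

injection⇒≤∣p∣ : ∀ {m n} (p : Subset n) (f : Fin m → Fin n) →
  (∀ {i j} → f i ≡ f j → i ≡ j) → (∀ i → f i ∈ p) → m ≤ ∣ p ∣
injection⇒≤∣p∣ {zero}  p f f-inj f∈p = z≤n
injection⇒≤∣p∣ {suc m} p f f-inj f∈p = ℕ.≤-trans
  (s≤s (injection⇒≤∣p∣ (p - f zero) (f ∘ suc) (suc-injective ∘ f-inj)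
    λ i → x∈p∧x≢y⇒x∈p-y (f∈p (suc i)) λ eq → 0≢1+n (sym (f-inj eq))))
  (x∈p⇒∣p-x∣<∣p∣ (f∈p zero))

funToFin-cong : ∀ {m n} {f g : Fin m → Fin n} → f ≗ g → funToFin f ≡ funToFin g
funToFin-cong {zero}  f≗g = refl
funToFin-cong {suc m} f≗g = cong₂ combine (f≗g zero) (funToFin-cong (f≗g ∘ suc))

finToFun-injective : ∀ {m n} {i j : Fin (n ^ m)} → finToFun {n} {m} i ≗ finToFun j → i ≡ j
finToFun-injective {m} {n} {i} {j} eq = trans (sym (funToFin-finToFin {m} {n} i))
  (trans (funToFin-cong eq) (funToFin-finToFin {m} {n} j))

-- Only removals of one element are tested; for a property passed on to supersets, such as
-- domination, this is minimality under inclusion.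
Minimal : ∀ {n} → (Subset n → Set) → Subset n → Set
Minimal P S = P S × (∀ y → y ∈ S → ¬ P (S - y))

minimal-subset : ∀ {n} {P : Subset n → Set} → Decidable P → ∀ S → P S → ∃ (Minimal P)
minimal-subset {P = P} P? S = go S (<-wellFounded ∣ S ∣)
  where
  go : ∀ S → Acc _<_ ∣ S ∣ → P S → ∃ (Minimal P)
  go S (acc rec) PS with any? (λ y → y ∈? S ×-dec P? (S - y))
  ... | yes (y , y∈S , P[S-y]) = go (S - y) (rec (x∈p⇒∣p-x∣<∣p∣ y∈S)) P[S-y]
  ... | no  none               = S , PS , λ y y∈S P[S-y] → none (y , y∈S , P[S-y])

-- r i v depends on v only when no value satisfies Q i; v then serves as a default.
Selects : ∀ {m} {I : Set} → (I → Fin m → Set) → (I → Fin m → Fin m) → Set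
Selects Q r = ∀ {i v} → Q i v → Q i (r i v) × (∀ {w} → Q i w → r i v ≡ r i w)

select : ∀ {m} {I : Set} {Q : I → Fin m → Set} → (∀ i → Decidable (Q i)) → ∃ (Selects Q)
select {m} {I} {Q} Q? = r , spec
  where
  r : I → Fin m → Fin m
  r i v with any? (Q? i)
  ... | yes (u , _) = u
  ... | no  _       = v

  spec : Selects Q r
  spec {i} {v} q with any? (Q? i)
  ... | yes (u , qu) = qu , λ _ → refl
  ... | no  none     = contradiction (v , q) none

-- Bipartite graphs

-- The edges are the elements of Fin m; edge u joins a u ∈ X to b u ∈ Y.
UniqueColorAt : ∀ {m q} (a b : Fin m → Fin q) → (Fin m → Maybe (Fin 2)) → Fin m → Set
UniqueColorAt a b col x =
  ∃[ k ] ∃! _≡_ (λ u → (a u ≡ a x ⊎ b u ≡ b x) × col u ≡ just k)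

module _ {m q} (a b : Fin m → Fin q)
  (ab-injective : ∀ {u v} → a u ≡ a v → b u ≡ b v → u ≡ v) where

  -- Ranging over edges `x`, rather than over vertices of X, leaves out the isolated vertices.
  Dominating : Subset q → Set
  Dominating S = ∀ x → ∃[ u ] (a u ≡ a x × b u ∈ S)

  dominating? : Decidable Dominating
  dominating? S = all? λ x → any? λ u → a u ≟ a x ×-dec b u ∈? S

  Private : Subset q → Fin m → Set
  Private S u = b u ∈ S × (∀ v → a v ≡ a u → b v ∈ S → b v ≡ b u)

  private? : ∀ S → Decidable (Private S)
  private? S u = b u ∈? S ×-dec all? λ v → a v ≟ a u →-dec (b v ∈? S →-dec b v ≟ b u)

  -- Since `S - y` fails to dominate, some X-vertex `a x` has no neighbour in `S` other than `y`. As
  -- `S` dominates, `a x` has an edge to `y`, and that edge is private.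
  minimal⇒private : ∀ {S} → Minimal Dominating S → ∀ {y} → y ∈ S → ∃[ u ] (b u ≡ y × Private S u)
  minimal⇒private {S} (dom , min) {y} y∈S =
    let x , ¬u = ¬∀⟶∃¬ m _ (λ x → any? λ u → a u ≟ a x ×-dec b u ∈? (S - y)) (min y y∈S)
        only-y = λ v av≡ax bv∈S → decidable-stable (b v ≟ y) λ bv≢y →
          ¬u (v , av≡ax , x∈p∧x≢y⇒x∈p-y bv∈S bv≢y)
        u , au≡ax , bu∈S = dom x
        bu≡y = only-y u au≡ax bu∈S
    in u , bu≡y , bu∈S , λ v av≡au bv∈S →
         trans (only-y v (trans av≡au au≡ax) bv∈S) (sym bu≡y)

  FromX : Subset q → Fin q → Fin m → Set
  FromX S i u = a u ≡ i × b u ∈ S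

  FromY : Subset q → Fin q → Fin m → Set
  FromY S i u = b u ≡ i × Private S u

  module _ (S : Subset q) (minimal : Minimal Dominating S)
    (rX rY : Fin q → Fin m → Fin m)
    (rX-selects : Selects (FromX S) rX) (rY-selects : Selects (FromY S) rY) where

    Chosen : Fin m → Set
    Chosen u = b u ∈ S × rX (a u) u ≡ u

    ChosenPrivate : Fin m → Set
    ChosenPrivate u = Private S u × rY (b u) u ≡ u

    chosen? : Decidable Chosen
    chosen? u = b u ∈? S ×-dec rX (a u) u ≟ u

    chosenPrivate? : Decidable ChosenPrivate
    chosenPrivate? u = private? S u ×-dec rY (b u) u ≟ u

    -- The X-end of a private edge has a single edge to `S`, so the selection at that end must pick
    -- it. Hence the non-blank edges are exactly the `Chosen` ones.
    chosenPrivate⇒chosen : ∀ {u} → ChosenPrivate u → Chosen u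
    chosenPrivate⇒chosen ((bu∈S , only) , _) =
      let aw≡au , bw∈S = proj₁ (rX-selects (refl , bu∈S))
      in bu∈S , ab-injective aw≡au (only _ aw≡au bw∈S)

    col : Fin m → Maybe (Fin 2)
    col u with chosenPrivate? u | chosen? u
    ... | yes _ | _     = just (suc zero)
    ... | no _  | yes _ = just zero
    ... | no _  | no _  = nothing

    col-chosenPrivate : ∀ {u} → ChosenPrivate u → col u ≡ just (suc zero)
    col-chosenPrivate {u} p with chosenPrivate? u | chosen? u
    ... | yes _ | _ = refl
    ... | no ¬p | _ = contradiction p ¬p

    col-chosenPrivate⁻ : ∀ {u} → col u ≡ just (suc zero) → ChosenPrivate u
    col-chosenPrivate⁻ {u} eq with chosenPrivate? u | chosen? u
    ... | yes p | _ = p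
    col-chosenPrivate⁻ () | no _ | yes _
    col-chosenPrivate⁻ () | no _ | no _

    col-chosen : ∀ {u} → Chosen u → ∃[ k ] col u ≡ just k
    col-chosen {u} c with chosenPrivate? u | chosen? u
    ... | yes _ | _     = _ , refl
    ... | no _  | yes _ = _ , refl
    ... | no _  | no ¬c = contradiction c ¬c

    col-chosen⁻ : ∀ {u k} → col u ≡ just k → Chosen u
    col-chosen⁻ {u} eq with chosenPrivate? u | chosen? u
    ... | yes p | _     = chosenPrivate⇒chosen p
    ... | no _  | yes c = c
    col-chosen⁻ () | no _ | no _

    unique : ∀ x → UniqueColorAt a b col x
    unique x with b x ∈? S
    ... | yes bx∈S =
      suc zero , w , (inj₂ bw≡bx , col-chosenPrivate chosen-w) , λ where
        (inj₂ bu≡bx , eq) → w-unique (col-chosenPrivate⁻ eq) bu≡bx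
        -- Here `x` also leads from `a u` into `S`, so privacy of `u` forces `b x ≡ b u`.
        (inj₁ au≡ax , eq) →
          let p = col-chosenPrivate⁻ eq
          in w-unique p (sym (proj₂ (proj₁ p) x (sym au≡ax) bx∈S))
      where
      w₀ = minimal⇒private minimal bx∈S
      w = rY (b x) (proj₁ w₀)
      w-spec = rY-selects (proj₂ w₀)
      bw≡bx = proj₁ (proj₁ w-spec)

      w-unique : ∀ {u} → ChosenPrivate u → b u ≡ b x → w ≡ u
      w-unique {u} (p , r≡u) bu≡bx = trans (proj₂ w-spec (bu≡bx , p))
        (trans (cong (λ i → rY i u) (sym bu≡bx)) r≡u)

      chosen-w : ChosenPrivate w
      -- `w` was selected with another default; selections do not depend on the default, so `w` also
      -- selects itself.
      chosen-w = proj₂ (proj₁ w-spec) ,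
        trans (cong (λ i → rY i w) bw≡bx) (sym (proj₂ w-spec (proj₁ w-spec)))
    -- Non-blank edges end in `S`, so none meets `x` at `b x`. Only the edge selected at `a x`
    -- remains, and its colour, 0 or 1, is the witness.
    ... | no bx∉S =
      proj₁ col-w , w , (inj₁ aw≡ax , proj₂ col-w) , λ where
        (inj₁ au≡ax , eq) → w-unique (col-chosen⁻ eq) au≡ax
        (inj₂ bu≡bx , eq) →
          contradiction (subst (_∈ S) bu≡bx (proj₁ (col-chosen⁻ eq))) bx∉S
      where
      w₀ = proj₁ minimal x
      w = rX (a x) (proj₁ w₀)
      w-spec = rX-selects (proj₂ w₀)
      aw≡ax = proj₁ (proj₁ w-spec)

      w-unique : ∀ {u} → Chosen u → a u ≡ a x → w ≡ u
      w-unique {u} (bu∈S , r≡u) au≡ax = trans (proj₂ w-spec (au≡ax , bu∈S))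
        (trans (cong (λ i → rX i u) (sym au≡ax)) r≡u)

      col-w : ∃[ k ] col w ≡ just k
      col-w = col-chosen (proj₂ (proj₁ w-spec) ,
        trans (cong (λ i → rX i w) aw≡ax) (sym (proj₂ w-spec (proj₁ w-spec))))

  bipartite-coloring : ∃[ col ] (∀ x → UniqueColorAt a b col x)
  bipartite-coloring =
    let S , minimal = minimal-subset dominating? ⊤ (λ x → x , refl , ∈⊤)
        rX , rX-selects = select {Q = FromX S} λ i u → a u ≟ i ×-dec b u ∈? S
        rY , rY-selects = select {Q = FromY S} λ i u → b u ≟ i ×-dec private? S u
    in col S minimal rX rY rX-selects rY-selects , unique S minimal rX rY rX-selects rY-selects

-- Greedy colouring

Proper : (H : Graph) {k : ℕ} → Coloring H k → Set
Proper H c = ∀ {u v} → Adj H u v → c u ≢ c v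

Free : (H : Graph) {k : ℕ} → Coloring H k → Vertex H → Fin k → Set
Free H c v a = ∀ u → Adj H v u → c u ≢ a

module _ (H : Graph) where
  open Graph H using (order; adj; adj-sym; adj-irrefl)

  Adj-sym : ∀ {u v} → Adj H u v → Adj H v u
  Adj-sym {u} {v} = subst T (adj-sym u v)

  Adj-irrefl : ∀ {u v} → Adj H u v → u ≢ v
  Adj-irrefl {u} uv refl = subst T (adj-irrefl u) uv

  free? : ∀ {k} (c : Coloring H k) v → Decidable (Free H c v)
  free? c v a = all? λ u → T? (adj v u) →-dec ¬? (c u ≟ a)

  -- Vertices are coloured in order of index. `free` is asked of every colouring, proper or not,
  -- because vertices still to be treated carry the default colour `a₀`, which counts as used.
  greedy : ∀ {k} → Fin k → (∀ (c : Coloring H k) v → ∃ (Free H c v)) → ∃[ c ] Proper H {k} c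
  greedy {k} a₀ free =
    let c , proper = go order ℕ.≤-refl in c , λ uv → proper (toℕ<n _) (toℕ<n _) uv
    where
    ProperBelow : ℕ → Coloring H k → Set
    ProperBelow i c = ∀ {u v} → toℕ u < i → toℕ v < i → Adj H u v → c u ≢ c v

    go : ∀ i → i ≤ order → ∃ (ProperBelow i)
    go zero    _   = (λ _ → a₀) , λ ()
    go (suc i) i<n = c′ , proper′
      where
      c = proj₁ (go i (ℕ.<⇒≤ i<n))
      proper = proj₂ (go i (ℕ.<⇒≤ i<n))
      w = fromℕ< i<n
      a = proj₁ (free c w)
      a-free = proj₂ (free c w)

      c′ : Coloring H k
      c′ u with u ≟ w
      ... | yes _ = a
      ... | no  _ = c u

      below : ∀ {u} → toℕ u < suc i → u ≢ w → toℕ u < i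
      below (s≤s u≤i) u≢w = ℕ.≤∧≢⇒< u≤i λ u≡i →
        u≢w (toℕ-injective (trans u≡i (sym (toℕ-fromℕ< i<n))))

      proper′ : ProperBelow (suc i) c′
      proper′ {u} {v} u≤i v≤i uv with u ≟ w | v ≟ w
      ... | yes u≡w  | yes v≡w  = contradiction (trans u≡w (sym v≡w)) (Adj-irrefl uv)
      ... | yes refl | no _     = ≢-sym (a-free v uv)
      ... | no _     | yes refl = a-free u (Adj-sym uv)
      ... | no u≢w   | no v≢w   = proper (below u≤i u≢w) (below v≤i v≢w) uv

-- Line graphs

module _ {H : Graph} where

  Edge-≡ : {e f : Edge H} → Edge.src e ≡ Edge.src f → Edge.tgt e ≡ Edge.tgt f → e ≡ f
  Edge-≡ {e} {f} refl refl
    with refl ← Fin.<-irrelevant (Edge.src<tgt e) (Edge.src<tgt f)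
       | refl ← T-irrelevant (Edge.joined e) (Edge.joined f) = refl

  -- The increasing order of endpoints excludes the crossed cases, where `e` and `f` would list `u`
  -- and `v` in opposite orders.
  common-ends⇒≡ : ∀ {u v} {e f : Edge H} → u ≢ v →
    u ∈ᵉ e → v ∈ᵉ e → u ∈ᵉ f → v ∈ᵉ f → e ≡ f
  common-ends⇒≡ u≢v (inj₁ refl) (inj₁ refl) _ _ = contradiction refl u≢v
  common-ends⇒≡ u≢v (inj₂ refl) (inj₂ refl) _ _ = contradiction refl u≢v
  common-ends⇒≡ u≢v _ _ (inj₁ refl) (inj₁ refl) = contradiction refl u≢v
  common-ends⇒≡ u≢v _ _ (inj₂ refl) (inj₂ refl) = contradiction refl u≢v
  common-ends⇒≡ _ (inj₁ p) (inj₂ q) (inj₁ r) (inj₂ s) = Edge-≡ (trans (sym p) r) (trans (sym q) s)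
  common-ends⇒≡ _ (inj₂ p) (inj₁ q) (inj₂ r) (inj₁ s) = Edge-≡ (trans (sym q) s) (trans (sym p) r)
  common-ends⇒≡ {e = e} {f} _ (inj₁ refl) (inj₂ refl) (inj₂ refl) (inj₁ refl) =
    contradiction (Edge.src<tgt f) (ℕ.<-asym (Edge.src<tgt e))
  common-ends⇒≡ {e = e} {f} _ (inj₂ refl) (inj₁ refl) (inj₁ refl) (inj₂ refl) =
    contradiction (Edge.src<tgt f) (ℕ.<-asym (Edge.src<tgt e))

  Joins : Edge H → Vertex H → Vertex H → Set
  Joins e u v = u ∈ᵉ e × v ∈ᵉ e × (∀ {w} → w ∈ᵉ e → w ≡ u ⊎ w ≡ v)

  edge : ∀ {u v} → Adj H u v → ∃[ e ] Joins e u v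
  edge {u} {v} uv with Fin.<-cmp u v
  ... | tri< u<v _ _ =
    record { src = u ; tgt = v ; src<tgt = u<v ; joined = uv } , inj₁ refl , inj₂ refl , λ p → p
  ... | tri≈ _ u≡v _ = contradiction u≡v (Adj-irrefl H uv)
  ... | tri> _ _ v<u =
    record { src = v ; tgt = u ; src<tgt = v<u ; joined = Adj-sym H uv } ,
    inj₂ refl , inj₁ refl , λ { (inj₁ p) → inj₂ p ; (inj₂ p) → inj₁ p }

module _ (G : Graph) where
  open Graph G using (adj; N⟨_⟩)

  Adj⇒∈N⟨⟩ : ∀ {x y} → Adj G x y → y ∈ N⟨ x ⟩
  Adj⇒∈N⟨⟩ {x} {y} xy =
    lookup⇒[]= y _ (trans (lookup∘tabulate (adj x) y) (Equivalence.to T-≡ xy))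

  ∈N⟨⟩⇒Adj : ∀ {x y} → y ∈ N⟨ x ⟩ → Adj G x y
  ∈N⟨⟩⇒Adj {x} {y} y∈ =
    Equivalence.from T-≡ (trans (sym (lookup∘tabulate (adj x) y)) ([]=⇒lookup y∈))

  degree≤maxDegree : ∀ x → degree G x ≤ maxDegree G
  degree≤maxDegree = tabulate⁻ (xs≤max 0 (List.tabulate (degree G)))

module _ (G H : Graph) (line : IsLineGraphOf G H) where
  private
    module φ = Inverse (proj₁ line)
    module Line x y = Equivalence (proj₂ line x y)

    φ-injective : ∀ {x y} → φ.to x ≡ φ.to y → x ≡ y
    φ-injective {x} {y} eq =
      trans (sym (φ.strictlyInverseʳ x)) (trans (cong φ.from eq) (φ.strictlyInverseʳ y))

  ∈N[]⇒share : ∀ {x u} → u ∈ N[_] G x → ShareEndpoint (φ.to x) (φ.to u)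
  ∈N[]⇒share {x} {u} u∈ with x∈p∪q⁻ _ _ u∈
  ... | inj₁ u∈N = proj₂ (Line.to x u (∈N⟨⟩⇒Adj G u∈N))
  ... | inj₂ u∈x with refl ← x∈⁅y⁆⇒x≡y x u∈x = Edge.src (φ.to x) , inj₁ refl , inj₁ refl

  share⇒∈N[] : ∀ {x u} → ShareEndpoint (φ.to x) (φ.to u) → u ∈ N[_] G x
  share⇒∈N[] {x} {u} s with u ≟ x
  ... | yes refl = x∈p∪q⁺ (inj₂ (x∈⁅x⁆ x))
  ... | no  u≢x  = x∈p∪q⁺ (inj₁ (Adj⇒∈N⟨⟩ G
    (Line.from x u ((λ eq → u≢x (sym (φ-injective eq))) , s))))

  -- Otherwise v has neighbours of all k colours, and the edges to them form a
  -- clique of size k in G.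
  free-color : ∀ {k} → suc (maxDegree G) < k → ∀ (c : Coloring H k) v → ∃ (Free H c v)
  free-color {suc k} (s≤s Δ<k) c v with any? (free? H c v)
  ... | yes found = found
  ... | no  none  = contradiction (ℕ.≤-trans clique (degree≤maxDegree G (x zero))) (ℕ.<⇒≱ Δ<k)
    where
    neighbor : ∀ a → ∃[ u ] (Adj H v u × c u ≡ a)
    neighbor a with any? (λ u → T? (Graph.adj H v u) ×-dec c u ≟ a)
    ... | yes found = found
    ... | no  ¬u    = contradiction (a , λ u vu eq → ¬u (u , vu , eq)) none

    e : ∀ a → ∃[ e ] Joins e v (proj₁ (neighbor a))
    e a = edge (proj₁ (proj₂ (neighbor a)))

    x : Fin (suc k) → Vertex G
    x a = φ.from (proj₁ (e a))

    φx : ∀ a → φ.to (x a) ≡ proj₁ (e a)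
    φx a = φ.strictlyInverseˡ (proj₁ (e a))

    e-injective : ∀ {a b} → proj₁ (e a) ≡ proj₁ (e b) → a ≡ b
    e-injective {a} {b} eq =
      let u , vu , cu≡a = neighbor a
          _ , _ , cw≡b = neighbor b
          _ , u∈e , _ = proj₂ (e a)
          _ , _ , ends = proj₂ (e b)
      in case ends (subst (u ∈ᵉ_) eq u∈e) of λ where
           (inj₁ u≡v) → contradiction (sym u≡v) (Adj-irrefl H vu)
           (inj₂ u≡w) → trans (sym cu≡a) (trans (cong c u≡w) cw≡b)

    x-injective : ∀ {a b} → x a ≡ x b → a ≡ b
    x-injective {a} {b} eq = e-injective (trans (sym (φx a)) (trans (cong φ.to eq) (φx b)))

    v∈x : ∀ a → v ∈ᵉ φ.to (x a)
    v∈x a = subst (v ∈ᵉ_) (sym (φx a)) (proj₁ (proj₂ (e a)))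

    -- The clique has `suc k` members, so `x zero` has at least `k` neighbours, more than
    -- `maxDegree G`.
    clique : k ≤ degree G (x zero)
    clique = injection⇒≤∣p∣ _ (x ∘ suc) (suc-injective ∘ x-injective) λ i →
      Adj⇒∈N⟨⟩ G (Line.from (x zero) (x (suc i))
        ((λ eq → 0≢1+n (x-injective (φ-injective eq))) , v , v∈x zero , v∈x (suc i)))

  -- Splitting the edges into bipartite levels

  module _ {L : ℕ} (bit : Vertex H → Fin L → Fin 2)
    (separates : ∀ {u v} → Adj H u v → ∃[ i ] bit u i ≢ bit v i) where

    -- The ends of an edge may differ in several bits; `level` fixes one of them, with `lo` on side
    -- X and `hi` on side Y.
    record Orientation (e : Edge H) : Set where
      field
        level  : Fin L
        lo hi  : Vertex H
        lo∈    : lo ∈ᵉ e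
        hi∈    : hi ∈ᵉ e
        lo-bit : bit lo level ≡ zero
        hi-bit : bit hi level ≡ suc zero
        ends   : ∀ {v} → v ∈ᵉ e → v ≡ lo ⊎ v ≡ hi

    orient : ∀ e → Orientation e
    orient e with separates (Edge.joined e)
    ... | i , ne with bit (Edge.src e) i in p | bit (Edge.tgt e) i in q
    ... | zero | zero = contradiction refl ne
    ... | zero | suc zero = record
      { level = i ; lo∈ = inj₁ refl ; hi∈ = inj₂ refl ; lo-bit = p ; hi-bit = q ; ends = λ v∈ → v∈ }
    ... | suc zero | zero = record
      { level = i ; lo∈ = inj₂ refl ; hi∈ = inj₁ refl ; lo-bit = q ; hi-bit = p
      ; ends = λ { (inj₁ r) → inj₂ r ; (inj₂ r) → inj₁ r } }
    ... | suc zero | suc zero = contradiction refl ne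

    private
      module O x = Orientation (orient (φ.to x))

      -- Tagging the ends with the level makes the disjoint union of all levels one bipartite graph,
      -- so a single bipartite colouring serves them all.
      a b : Vertex G → Fin (L * Graph.order H)
      a x = combine (O.level x) (O.lo x)
      b x = combine (O.level x) (O.hi x)

      a-injective : ∀ {x y} → a x ≡ a y → O.level x ≡ O.level y × O.lo x ≡ O.lo y
      a-injective {x} {y} = combine-injective (O.level x) (O.lo x) (O.level y) (O.lo y)

      b-injective : ∀ {x y} → b x ≡ b y → O.level x ≡ O.level y × O.hi x ≡ O.hi y
      b-injective {x} {y} = combine-injective (O.level x) (O.hi x) (O.level y) (O.hi y)

      -- At a fixed level a vertex has one bit, so it lies on one side only.
      lo≢hi : ∀ {x y} → O.level x ≡ O.level y → O.lo x ≢ O.hi y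
      lo≢hi {x} {y} l≡ lo≡hi = 0≢1+n (trans (sym (O.lo-bit x))
        (trans (cong (bit (O.lo x)) l≡) (trans (cong (λ v → bit v (O.level y)) lo≡hi) (O.hi-bit y))))

      ab-injective : ∀ {x y} → a x ≡ a y → b x ≡ b y → x ≡ y
      ab-injective {x} {y} a≡ b≡ = φ-injective (common-ends⇒≡ (lo≢hi {x} {x} refl)
        (O.lo∈ x) (O.hi∈ x)
        (subst (_∈ᵉ φ.to y) (sym (proj₂ (a-injective a≡))) (O.lo∈ y))
        (subst (_∈ᵉ φ.to y) (sym (proj₂ (b-injective b≡))) (O.hi∈ y)))

      meet⇒∈N[] : ∀ {x u} → a u ≡ a x ⊎ b u ≡ b x → u ∈ N[_] G x
      meet⇒∈N[] {x} {u} (inj₁ a≡) = share⇒∈N[]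
        (O.lo x , O.lo∈ x , subst (_∈ᵉ φ.to u) (proj₂ (a-injective a≡)) (O.lo∈ u))
      meet⇒∈N[] {x} {u} (inj₂ b≡) = share⇒∈N[]
        (O.hi x , O.hi∈ x , subst (_∈ᵉ φ.to u) (proj₂ (b-injective b≡)) (O.hi∈ u))

      meet⇒level : ∀ {x u} → a u ≡ a x ⊎ b u ≡ b x → O.level u ≡ O.level x
      meet⇒level = [ proj₁ ∘ a-injective , proj₁ ∘ b-injective ]′

      ∈N[]⇒meet : ∀ {x u} → O.level u ≡ O.level x → u ∈ N[_] G x → a u ≡ a x ⊎ b u ≡ b x
      ∈N[]⇒meet {x} {u} l≡ u∈ with v , v∈x , v∈u ← ∈N[]⇒share u∈ with O.ends x v∈x | O.ends u v∈u
      ... | inj₁ p | inj₁ q = inj₁ (cong₂ combine l≡ (trans (sym q) p))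
      ... | inj₂ p | inj₂ q = inj₂ (cong₂ combine l≡ (trans (sym q) p))
      ... | inj₁ p | inj₂ q = contradiction (trans (sym p) q) (lo≢hi {x} {u} (sym l≡))
      ... | inj₂ p | inj₁ q = contradiction (trans (sym q) p) (lo≢hi {u} {x} l≡)

    -- Colour `zero` is the blank. Every other colour records its level, so edges of other levels,
    -- though possibly adjacent to `x`, cannot repeat the colour that is unique at the level of `x`.
    combine-levels : ∀ col → (∀ x → UniqueColorAt a b col x) → ConflictFreeColorable G (suc (L * 2))
    combine-levels col unique-at = c , conflictFree
      where
      c : Coloring G (suc (L * 2))
      c u = maybe′ (λ k → suc (combine (O.level u) k)) zero (col u)

      c-just : ∀ {u k} → col u ≡ just k → c u ≡ suc (combine (O.level u) k)
      c-just {u} eq = cong (maybe′ (λ k → suc (combine (O.level u) k)) zero) eq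

      c-just⁻ : ∀ {u i k} → c u ≡ suc (combine i k) → O.level u ≡ i × col u ≡ just k
      c-just⁻ {u} {i} {k} eq with col u
      ... | just k′ = let l≡i , k′≡k = combine-injective (O.level u) k′ i k (suc-injective eq)
                      in l≡i , cong just k′≡k
      c-just⁻ () | nothing

      conflictFree : ConflictFree G c
      conflictFree x with unique-at x
      ... | k , w , (meet , cw) , unique =
        suc (combine (O.level x) k) , w ,
        (meet⇒∈N[] meet , trans (c-just cw) (cong (λ i → suc (combine i k)) (meet⇒level meet))) ,
        λ (u∈ , cu) → let l≡ , eq = c-just⁻ cu in unique (∈N[]⇒meet l≡ u∈ , eq)

    separated⇒colorable : ConflictFreeColorable G (suc (L * 2))
    separated⇒colorable =
      let col , unique-at = bipartite-coloring a b ab-injective in combine-levels col unique-at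

  -- The bits of a vertex are the binary digits of its colour in a proper colouring with `2 ^ L`
  -- colours; distinct colours differ in some digit.
  lineGraph-colorable : ∀ {L} → suc (maxDegree G) < 2 ^ L → ConflictFreeColorable G (suc (L * 2))
  lineGraph-colorable {L} Δ<2^L = separated⇒colorable (λ v → finToFun (c v)) separates
    where
    coloring = greedy H (fromℕ< (ℕ.≤-trans (s≤s z≤n) Δ<2^L)) (free-color Δ<2^L)
    c = proj₁ coloring

    separates : ∀ {u v} → Adj H u v → ∃[ i ] finToFun {2} {L} (c u) i ≢ finToFun (c v) i
    separates {u} {v} uv = ¬∀⟶∃¬ L _ (λ i → finToFun {2} {L} (c u) i ≟ finToFun (c v) i) λ same →
      proj₂ coloring uv (finToFun-injective {L} same)

-- Estimates

-- Strictness carries the induction: the spare 1, multiplied by `suc m`, absorbs both the `+ 1` of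
-- the recursion and the new strictness. This takes `suc m` at least 2, hence two base cases.
expNum<4*! : ∀ n → expNum n < 4 * n !
expNum<4*! 0 = s≤s (s≤s z≤n)
expNum<4*! 1 = s≤s (s≤s (s≤s z≤n))
expNum<4*! (suc m@(suc n)) = begin
  suc (suc m * expNum m + 1)  ≡⟨ solve 2 (λ k x → con 1 :+ (k :* x :+ con 1) := k :* x :+ con 2) refl (suc m) (expNum m) ⟩
  suc m * expNum m + 2        ≤⟨ ℕ.+-monoʳ-≤ (suc m * expNum m) (s≤s (s≤s z≤n)) ⟩
  suc m * expNum m + suc m    ≡⟨ solve 2 (λ k x → k :* x :+ k := k :* (con 1 :+ x)) refl (suc m) (expNum m) ⟩
  suc m * suc (expNum m)      ≤⟨ ℕ.*-monoʳ-≤ (suc m) (expNum<4*! m) ⟩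
  suc m * (4 * m !)           ≡⟨ solve 2 (λ k x → k :* (con 4 :* x) := con 4 :* (k :* x)) refl (suc m) (m !) ⟩
  4 * suc m !                 ∎
  where open ℕ.≤-Reasoning

^-distribʳ-* : ∀ o m n → (m * n) ^ o ≡ m ^ o * n ^ o
^-distribʳ-* zero    m n = refl
^-distribʳ-* (suc o) m n = trans (cong (m * n *_) (^-distribʳ-* o m n))
  (solve 4 (λ a b c d → a :* b :* (c :* d) := a :* c :* (b :* d)) refl m n (m ^ o) (n ^ o))

-- Every partial sum of the series for e is below 4.
4^⇒·ln : ∀ {m C N} → 4 ^ m ≤ N ^ C → m ≤ C ·ln N
4^⇒·ln {m} {C} {N} 4^m≤N^C n = begin
  expNum n ^ m       ≤⟨ ℕ.^-monoˡ-≤ m (ℕ.<⇒≤ (expNum<4*! n)) ⟩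
  (4 * n !) ^ m      ≡⟨ ^-distribʳ-* m 4 (n !) ⟩
  4 ^ m * (n !) ^ m    ≤⟨ ℕ.*-monoˡ-≤ ((n !) ^ m) 4^m≤N^C ⟩
  N ^ C * (n !) ^ m    ∎
  where open ℕ.≤-Reasoning

-- The power is doubled only when `suc n` has reached it, which keeps it within twice the required
-- size.
power-of-2-above : ∀ n → ∃[ L ] (n < 2 ^ L × 2 ^ L ≤ 2 * suc n)
power-of-2-above zero = 0 , s≤s z≤n , s≤s z≤n
power-of-2-above (suc n) with power-of-2-above n
... | L , n<2^L , 2^L≤ with suc n ℕ.<? 2 ^ L
...   | yes n+1<2^L = L , n+1<2^L , ℕ.≤-trans 2^L≤ (ℕ.*-monoʳ-≤ 2 (ℕ.n≤1+n (suc n)))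
...   | no  n+1≮2^L = suc L ,
        ℕ.≤-<-trans n<2^L (ℕ.^-monoʳ-< 2 (s≤s (s≤s z≤n)) (ℕ.n<1+n L)) ,
        ℕ.*-monoʳ-≤ 2 (ℕ.m≤n⇒m≤1+n (ℕ.≮⇒≥ n+1≮2^L))

2*[2+n]≤n^2 : ∀ {n} → 4 ≤ n → 2 * (2 + n) ≤ n ^ 2
2*[2+n]≤n^2 {n} 4≤n with d , refl ← ℕ.m≤n⇒∃[o]m+o≡n 4≤n = begin
  2 * (2 + (4 + d))                           ≤⟨ ℕ.m≤m+n _ (4 + 6 * d + d * d) ⟩
  2 * (2 + (4 + d)) + (4 + 6 * d + d * d)     ≡⟨ solve 1 (λ d → con 2 :* (con 2 :+ (con 4 :+ d)) :+ (con 4 :+ con 6 :* d :+ d :* d) := (con 4 :+ d) :^ 2) refl d ⟩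
  (4 + d) ^ 2                                 ∎
  where open ℕ.≤-Reasoning

-- The exponent is 9 = 1 + 8: one factor `4 ≤ N` pays for the blank colour, and `4 ^ (L * 2)` equals
-- `(2 ^ L) ^ 4`, at most `N ^ 8`.
4^[1+L*2]≤N^9 : ∀ {L N} → 4 ≤ N → 2 ^ L ≤ N ^ 2 → 4 ^ suc (L * 2) ≤ N ^ 9
4^[1+L*2]≤N^9 {L} {N} 4≤N 2^L≤N^2 = ℕ.*-mono-≤ 4≤N (begin
  4 ^ (L * 2)        ≡⟨ ℕ.^-*-assoc 2 2 (L * 2) ⟩
  2 ^ (2 * (L * 2))  ≡⟨ cong (2 ^_) (solve 1 (λ l → con 2 :* (l :* con 2) := l :* con 4) refl L) ⟩
  2 ^ (L * 4)        ≡⟨ ℕ.^-*-assoc 2 L 4 ⟨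
  (2 ^ L) ^ 4        ≤⟨ ℕ.^-monoˡ-≤ 4 2^L≤N^2 ⟩
  (N ^ 2) ^ 4        ≡⟨ ℕ.^-*-assoc N 2 4 ⟩
  N ^ 8              ∎)
  where open ℕ.≤-Reasoning

theorem2 : ∃[ C ] ∃[ Δ₀ ] (0 < C × (∀ (G : Graph) → IsLineGraph G → Δ₀ ≤ maxDegree G → χCF G ≤ C ·ln maxDegree G))
-- The threshold 4 gives `2 * (2 + Δ) ≤ Δ ^ 2`, which turns the bound on `2 ^ L` into
-- `2 ^ L ≤ Δ ^ 2`; it also supplies the extra factor 4 in the power 9.
theorem2 = 9 , 4 , s≤s z≤n , λ G (H , line) 4≤Δ →
  let L , Δ<2^L , 2^L≤ = power-of-2-above (suc (maxDegree G))
      χCF≤ = proj₂ (χCF-isLeast G) (suc (L * 2)) (lineGraph-colorable G H line {L} Δ<2^L)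
  in 4^⇒·ln {χCF G} {9} {maxDegree G} (ℕ.≤-trans (ℕ.^-monoʳ-≤ 4 χCF≤)
       (4^[1+L*2]≤N^9 {L} 4≤Δ (ℕ.≤-trans 2^L≤ (2*[2+n]≤n^2 4≤Δ))))
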